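{- Let $k\geq 3$ be an integer. Then $\mathcal{D}_k(\vec{C}_7\langle 3\rangle)$ is connected and has diameter $8$.
   Context: $\vec{C}_7\langle 3\rangle$ is the tournament with vertex set $\mathbb{Z}_7$ and arcs $(a,a+1)$, $(a,a+2)$, $(a,a-3)$ for all $a\in\mathbb{Z}_7$ (equivalently the Paley tournament $\vec{C}_7(1,2,4)$). A $k$-coloring of a digraph $D$ is a function $\alpha\colon V(D)\to\{1,\dots,k\}$ such that every color class $\{x:\alpha(x)=i\}$ (possibly empty) induces an acyclic subdigraph. The $k$-dicoloring graph $\mathcal{D}_k(D)$ has the $k$-colorings of $D$ as vertices, two being adjacent iff they differ on exactly one vertex. -}

module Defs where

open import Data.Nat using (ℕ; zero; suc; _+_; _≤_)
open import Data.Nat.DivMod using (_%_)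
open import Data.Fin using (Fin; toℕ)
open import Data.List using (List; []; _∷_)
open import Data.List.Relation.Unary.All using (All)
open import Data.List.Relation.Unary.Unique.Propositional using (Unique)
open import Data.Product using (Σ; ∃; _×_; _,_; proj₁)
open import Data.Sum using (_⊎_)
open import Relation.Nullary using (¬_)
open import Relation.Binary.PropositionalEquality using (_≡_; _≢_)

Digraph : ℕ → Set₁
Digraph n = Fin n → Fin n → Set

-- C⃗₇⟨3⟩: vertex set ℤ₇ (= Fin 7), arcs (a,a+1), (a,a+2), (a,a-3) = (a,a+4).
C7⟨3⟩ : Digraph 7
C7⟨3⟩ a b = (toℕ b ≡ (toℕ a + 1) % 7)
          ⊎ (toℕ b ≡ (toℕ a + 2) % 7)
          ⊎ (toℕ b ≡ (toℕ a + 4) % 7)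

data ChainFrom {n : ℕ} (D : Digraph n) : Fin n → List (Fin n) → Fin n → Set where
  end  : ∀ {x} → ChainFrom D x [] x
  step : ∀ {x y z zs} → D x y → ChainFrom D y zs z → ChainFrom D x (y ∷ zs) z

record DirectedCycle {n : ℕ} (D : Digraph n) : Set where
  field
    first  : Fin n
    rest   : List (Fin n)
    last   : Fin n
    chain  : ChainFrom D first rest last
    close  : D last first
    unique : Unique (first ∷ rest)

InducesAcyclic : {n : ℕ} → Digraph n → (Fin n → Set) → Set
InducesAcyclic {n} D S =
  (C : DirectedCycle D) → ¬ All S (DirectedCycle.first C ∷ DirectedCycle.rest C)

IsDicoloring : {n : ℕ} → Digraph n → (k : ℕ) → (Fin n → Fin k) → Set
IsDicoloring D k α = (i : Fin k) → InducesAcyclic D (λ x → α x ≡ i)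

Coloring : {n : ℕ} → Digraph n → ℕ → Set
Coloring {n} D k = Σ (Fin n → Fin k) (IsDicoloring D k)

Adjacent : {n : ℕ} {D : Digraph n} {k : ℕ} → Coloring D k → Coloring D k → Set
Adjacent {n} (α , _) (β , _) =
  Σ (Fin n) λ v → (α v ≢ β v) × ((u : Fin n) → u ≢ v → α u ≡ β u)

SameColoring : {n : ℕ} {D : Digraph n} {k : ℕ} → Coloring D k → Coloring D k → Set
SameColoring {n} (α , _) (β , _) = (x : Fin n) → α x ≡ β x

data Walk {n : ℕ} {D : Digraph n} {k : ℕ} : Coloring D k → Coloring D k → ℕ → Set where
  here : ∀ {α β} → SameColoring α β → Walk α β 0
  next : ∀ {α β γ ℓ} → Adjacent α β → Walk β γ ℓ → Walk α γ (suc ℓ)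

Connected : {n : ℕ} → Digraph n → ℕ → Set
Connected D k = (α β : Coloring D k) → ∃ λ ℓ → Walk α β ℓ

HasDiameter : {n : ℕ} → Digraph n → ℕ → ℕ → Set
HasDiameter D k d =
  ((α β : Coloring D k) → ∃ λ ℓ → ℓ ≤ d × Walk α β ℓ)
  × (Σ (Coloring D k) λ α → Σ (Coloring D k) λ β →
       (ℓ : ℕ) → Walk α β ℓ → d ≤ ℓ)

{-# OPTIONS --safe #-}
module Submission where

-- A set of vertices is acyclic iff it contains no cyclic triangle.
--
-- Upper bound: give the vertices their final colors as long as some vertex allows it. In a
-- stuck pair (α, β) the colors of β all occur in α, because a color unused by α blocks no
-- vertex, so up to renaming colors α is one of finitely many partitions of the vertices
-- and β a coloring by its classes. If k ≥ 4, exhaustive search shows that one extra move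
-- resolves every stuck pair. If k = 3, two extra moves suffice, which settles all pairs
-- that differ on at most six vertices; for the pairs that differ everywhere, a walk of
-- length 8 is found by exhaustive search as well.
--
-- Lower bound: for a pair that differs everywhere, a walk of length 7 must give a vertex
-- its final color at every move. For a₀ and b₀ below no order of these moves works, and
-- this does not depend on k because no further color is ever used.

open import Defs
open import Data.Bool.ListAction using (all)
open import Data.Bool.Base using (Bool; true; false; if_then_else_; not; _∧_; T)
open import Data.Bool.Properties using (T-∧)
open import Data.Empty using (⊥-elim)
open import Data.Fin.Base using (Fin; zero; suc; inject≤)
open import Data.Fin.Patterns
open import Data.Fin.Properties
  using (_≟_; any?; all?; injective⇒≤; inject≤-injective)
open import Data.List.Base as List
  using (List; []; _∷_; allFin; concatMap; cartesianProduct; cartesianProductWith;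
         filter; mapMaybe)
open import Data.List.Membership.Propositional using (_∈_)
open import Data.List.Membership.Propositional.Properties
  using (∈-allFin; ∈-filter⁺; ∈-map⁺; ∈-concatMap⁺; ∈-cartesianProductWith⁺)
open import Data.List.Relation.Unary.All as All using (All; []; _∷_)
open import Data.List.Relation.Unary.All.Properties using (all⁺; all⁻)
open import Data.List.Relation.Unary.Any as Any using (Any; here; there)
open import Data.List.Relation.Unary.AllPairs using ([]; _∷_)
open import Data.Maybe.Base as Maybe using (Maybe; just; nothing; is-just; _<∣>_)
open import Data.Maybe using (to-witness-T)
import Data.Nat.Properties as ℕ
open import Data.Nat.Base using (ℕ; zero; suc; _+_; _≤_; _<_; z≤n; s≤s; s≤s⁻¹; _≤ᵇ_)
open import Data.Product using (Σ; ∃; _×_; _,_; proj₁; proj₂; uncurry)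
open import Data.Product.Properties renaming (≡-dec to ×-≡-dec)
open import Data.Sum using (_⊎_; inj₁; inj₂)
open import Data.Unit.Base using (tt)
open import Data.Vec.Base as Vec using (Vec; []; _∷_; lookup; tabulate; _[_]≔_)
import Data.Vec.Functional as F
import Data.Vec.Functional.Properties as F
open import Data.Vec.Properties
  using (≡-dec; lookup∘tabulate; lookup∘update; lookup∘update′; lookup-map)
open import Function.Base using (_∘_; const)
open import Function.Bundles using (Equivalence)
open import Function.Definitions using (Injective)
open import Relation.Binary.PropositionalEquality
open import Relation.Nullary
open import Relation.Nullary.Decidable using (from-yes; from-no; does; map′; T?)
open import Relation.Nullary.Reflects using (invert)

private variable
  k m n ℓ s : ℕ

-- Cyclic triangles and acyclic color classes

Triple : Set
Triple = Fin 7 × Fin 7 × Fin 7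

-- i → i + 1 → i + 3 → i and i → i + 2 → i + 3 → i.
triangles : List Triple
triangles =
  (0F , 1F , 3F) ∷ (1F , 2F , 4F) ∷ (2F , 3F , 5F) ∷ (3F , 4F , 6F) ∷
  (4F , 5F , 0F) ∷ (5F , 6F , 1F) ∷ (6F , 0F , 2F) ∷
  (0F , 2F , 3F) ∷ (1F , 3F , 4F) ∷ (2F , 4F , 5F) ∷ (3F , 5F , 6F) ∷
  (4F , 6F , 0F) ∷ (5F , 0F , 1F) ∷ (6F , 1F , 2F) ∷ []

Cyclic : Triple → Set
Cyclic (x , y , z) = C7⟨3⟩ x y × C7⟨3⟩ y z × C7⟨3⟩ z x

Mono : ∀ {A : Set} → (Fin 7 → A) → Triple → Set
Mono f (x , y , z) = f x ≡ f y × f y ≡ f z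

Proper : ∀ {A : Set} → (Fin 7 → A) → Set
Proper f = All (¬_ ∘ Mono f) triangles

proper? : (f : Fin 7 → Fin k) → Dec (Proper f)
proper? f = All.all? (λ (x , y , z) → ¬? ((f x ≟ f y) ×-dec (f y ≟ f z))) triangles

arc? : ∀ a b → Dec (C7⟨3⟩ a b)
arc? a b = (_ ℕ.≟ _) ⊎-dec (_ ℕ.≟ _) ⊎-dec (_ ℕ.≟ _)

-- The exhaustive checks are opaque because their normal forms are huge.
opaque
  loopless : ∀ a → ¬ C7⟨3⟩ a a
  loopless = from-yes (all? λ a → ¬? (arc? a a))

  asymmetric : ∀ a b → C7⟨3⟩ a b → ¬ C7⟨3⟩ b a
  asymmetric = from-yes (all? λ a → all? λ b → arc? a b →-dec ¬? (arc? b a))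

  total : ∀ a b → a ≡ b ⊎ C7⟨3⟩ a b ⊎ C7⟨3⟩ b a
  total = from-yes (all? λ a → all? λ b → (a ≟ b) ⊎-dec arc? a b ⊎-dec arc? b a)

  triangles-complete : ∀ x y z → C7⟨3⟩ x y → C7⟨3⟩ y z → C7⟨3⟩ z x →
    (x , y , z) ∈ triangles ⊎ (y , z , x) ∈ triangles ⊎ (z , x , y) ∈ triangles
  triangles-complete = from-yes (all? λ x → all? λ y → all? λ z →
    arc? x y →-dec arc? y z →-dec arc? z x →-dec
    (listed? (x , y , z) ⊎-dec listed? (y , z , x) ⊎-dec listed? (z , x , y)))
    where
    listed? : ∀ t → Dec (t ∈ triangles)
    listed? t = Any.any? (×-≡-dec _≟_ (×-≡-dec _≟_ _≟_) t) triangles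

  triangles-sound : All Cyclic triangles
  triangles-sound = from-yes
    (All.all? (λ (x , y , z) → arc? x y ×-dec arc? y z ×-dec arc? z x) triangles)

arc⇒≢ : ∀ {x y} → C7⟨3⟩ x y → x ≢ y
arc⇒≢ xy refl = loopless _ xy

mono-triangle : ∀ {A : Set} {f : Fin 7 → A} {i x y z} → Proper f →
  C7⟨3⟩ x y → C7⟨3⟩ y z → C7⟨3⟩ z x → f x ≡ i → f y ≡ i → ¬ f z ≡ i
mono-triangle ok xy yz zx fx fy fz with triangles-complete _ _ _ xy yz zx
... | inj₁ t        = All.lookup ok t (trans fx (sym fy) , trans fy (sym fz))
... | inj₂ (inj₁ t) = All.lookup ok t (trans fy (sym fz) , trans fz (sym fx))
... | inj₂ (inj₂ t) = All.lookup ok t (trans fz (sym fx) , trans fx (sym fy))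

-- The chain starts at an out-neighbour of a and ends at an in-neighbour; where it
-- changes sides, the two vertices form a cyclic triangle with a.
no-mono-cycle : ∀ {A : Set} {f : Fin 7 → A} {i a y z zs} → Proper f → f a ≡ i → C7⟨3⟩ a y →
  ChainFrom C7⟨3⟩ y zs z → C7⟨3⟩ z a → ¬ All (λ x → f x ≡ i) (y ∷ zs)
no-mono-cycle ok fa ay end za _ = asymmetric _ _ ay za
no-mono-cycle {a = a} ok fa ay (step {y = y′} yy′ chain) za (fy ∷ fs@(fy′ ∷ _))
  with total a y′
... | inj₁ refl        = asymmetric _ _ ay yy′
... | inj₂ (inj₁ ay′)  = no-mono-cycle ok fa ay′ chain za fs
... | inj₂ (inj₂ y′a)  = mono-triangle ok ay yy′ y′a fa fy fy′

proper⇒dicoloring : {f : Fin 7 → Fin k} → Proper f → IsDicoloring C7⟨3⟩ k f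
proper⇒dicoloring ok i C (fa ∷ fs) with DirectedCycle.chain C
... | end           = loopless _ (DirectedCycle.close C)
... | step ay chain = no-mono-cycle ok fa ay chain (DirectedCycle.close C) fs

dicoloring⇒proper : {f : Fin 7 → Fin k} → IsDicoloring C7⟨3⟩ k f → Proper f
dicoloring⇒proper {f = f} acyclic = All.map no-mono triangles-sound
  where
  no-mono : ∀ {t} → Cyclic t → ¬ Mono f t
  no-mono {x , y , z} (xy , yz , zx) (fx≡fy , fy≡fz) = acyclic (f x)
    (record { first = x ; rest = y ∷ z ∷ [] ; last = z ; chain = step xy (step yz end) ; close = zx
            ; unique = (arc⇒≢ xy ∷ arc⇒≢ zx ∘ sym ∷ []) ∷ (arc⇒≢ yz ∷ []) ∷ [] ∷ [] })
    (refl ∷ sym fx≡fy ∷ sym (trans fx≡fy fy≡fz) ∷ [])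

-- Colorings and recoloring

Col : ℕ → Set
Col = Coloring C7⟨3⟩

proper : (α : Col k) → Proper (proj₁ α)
proper (α , acyclic) = dicoloring⇒proper acyclic

coloring : {f : Fin 7 → Fin k} → Proper f → Col k
coloring ok = _ , proper⇒dicoloring ok

Proper-resp : ∀ {A : Set} {f g : Fin 7 → A} → f ≗ g → Proper f → Proper g
Proper-resp f≗g = All.map λ ok (e , e′) →
  ok (trans (f≗g _) (trans e (sym (f≗g _))) , trans (f≗g _) (trans e′ (sym (f≗g _))))

Proper-∘ : ∀ {A B : Set} {h : A → B} {f : Fin 7 → A} → Injective _≡_ _≡_ h →
  Proper f → Proper (h ∘ f)
Proper-∘ inj = All.map λ ok (e , e′) → ok (inj e , inj e′)

Proper-∘⁻ : ∀ {A B : Set} (h : A → B) (f : Fin 7 → A) → Proper (h ∘ f) → Proper f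
Proper-∘⁻ h f = All.map λ ok (e , e′) → ok (cong h e , cong h e′)

recolor : ∀ {A : Set} → (Fin n → A) → Fin n → A → Fin n → A
recolor f v c = F.updateAt f v (const c)

recolor-here : ∀ {A : Set} (f : Fin n → A) v {c} → recolor f v c v ≡ c
recolor-here f v = F.updateAt-updates v f

recolor-there : ∀ {A : Set} (f : Fin n → A) v {c u} → u ≢ v → recolor f v c u ≡ f u
recolor-there f v u≢v = F.updateAt-minimal _ v f u≢v

lookup-recolor : (h : Fin m → Fin k) {f : Fin 7 → Fin k} (a : Vec (Fin m) 7) → f ≗ h ∘ lookup a →
  ∀ v c → recolor f v (h c) ≗ h ∘ lookup (a [ v ]≔ c)
lookup-recolor h {f} a f≗ha v c u with u ≟ v
... | yes refl = trans (recolor-here f v) (cong h (sym (lookup∘update v a c)))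
... | no u≢v   = trans (recolor-there f v u≢v)
                   (trans (f≗ha u) (cong h (sym (lookup∘update′ u≢v a c))))

-- Afterwards `c` occurs at `v` only, so a monochromatic triangle would have to avoid `v` and be
-- monochromatic under `f` already.
recolor-unused : (f : Fin 7 → Fin k) → Proper f → ∀ v c → (∀ w → f w ≢ c) → Proper (recolor f v c)
recolor-unused f ok v c unused = All.zipWith (uncurry still) (triangles-sound , ok)
  where
  still : ∀ {t} → Cyclic t → ¬ Mono f t → ¬ Mono (recolor f v c) t
  still {x , y , z} (xy , _) notmono (e , e′) with x ≟ v | y ≟ v | z ≟ v
  ... | yes refl | yes refl | _ = loopless _ xy
  ... | yes refl | no y≢v | _ =
    unused y (trans (sym (recolor-there f v y≢v)) (trans (sym e) (recolor-here f v)))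
  ... | no x≢v | yes refl | _ =
    unused x (trans (sym (recolor-there f v x≢v)) (trans e (recolor-here f v)))
  ... | no x≢v | no y≢v | yes refl =
    unused y (trans (sym (recolor-there f v y≢v)) (trans e′ (recolor-here f v)))
  ... | no x≢v | no y≢v | no z≢v = notmono
    ( trans (sym (recolor-there f v x≢v)) (trans e (recolor-there f v y≢v))
    , trans (sym (recolor-there f v y≢v)) (trans e′ (recolor-there f v z≢v)) )

-- Hamming distance

hamming : (f g : Fin n → Fin k) → ℕ
hamming {n = zero}  f g = 0
hamming {n = suc n} f g =
  if does (f zero ≟ g zero) then rest else suc rest
  where rest = hamming (f ∘ suc) (g ∘ suc)

hamming≤n : (f g : Fin n → Fin k) → hamming f g ≤ n
hamming≤n {zero}  f g = z≤n
hamming≤n {suc n} f g with f zero ≟ g zero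
... | yes _ = ℕ.m≤n⇒m≤1+n (hamming≤n (f ∘ suc) (g ∘ suc))
... | no  _ = s≤s (hamming≤n (f ∘ suc) (g ∘ suc))

n≤hamming⇒≢ : (f g : Fin n → Fin k) → n ≤ hamming f g → ∀ v → f v ≢ g v
n≤hamming⇒≢ {suc n} f g n≤ v with f zero ≟ g zero
n≤hamming⇒≢ {suc n} f g n≤ v       | yes _  =
  ⊥-elim (ℕ.1+n≰n (ℕ.≤-trans n≤ (hamming≤n (f ∘ suc) (g ∘ suc))))
n≤hamming⇒≢ {suc n} f g n≤ zero    | no f≢g = f≢g
n≤hamming⇒≢ {suc n} f g n≤ (suc v) | no _   = n≤hamming⇒≢ (f ∘ suc) (g ∘ suc) (s≤s⁻¹ n≤) v

-- Compares pairs over different numbers of colors; this covers injective renaming of colors as well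
-- as replacing functions by pointwise equal ones.
hamming-anti : (f g : Fin n → Fin k) (f′ g′ : Fin n → Fin m) →
  (∀ v → f′ v ≡ g′ v → f v ≡ g v) → hamming f g ≤ hamming f′ g′
hamming-anti {zero}  f g f′ g′ eq = z≤n
hamming-anti {suc n} f g f′ g′ eq with f zero ≟ g zero | f′ zero ≟ g′ zero
... | yes _  | yes _ = hamming-anti _ _ _ _ (eq ∘ suc)
... | yes _  | no _  = ℕ.m≤n⇒m≤1+n (hamming-anti _ _ _ _ (eq ∘ suc))
... | no f≢g | yes e = ⊥-elim (f≢g (eq zero e))
... | no _   | no _  = s≤s (hamming-anti _ _ _ _ (eq ∘ suc))

hamming-recolor : (f g : Fin n → Fin k) → ∀ v → f v ≢ g v →
  hamming f g ≡ suc (hamming (recolor f v (g v)) g)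
hamming-recolor {suc n} f g zero f≢g with f zero ≟ g zero | g zero ≟ g zero
... | yes e | _     = ⊥-elim (f≢g e)
... | no _  | yes _ = refl
... | no _  | no ¬r = ⊥-elim (¬r refl)
hamming-recolor {suc n} f g (suc v) f≢g with f zero ≟ g zero
... | yes _ = hamming-recolor (f ∘ suc) (g ∘ suc) v f≢g
... | no  _ = cong suc (hamming-recolor (f ∘ suc) (g ∘ suc) v f≢g)

-- Bounded walks, and paths in a small palette

Within : ℕ → Col k → Col k → Set
Within n α β = ∃ λ ℓ → ℓ ≤ n × Walk α β ℓ

Within-mono : {α β : Col k} → m ≤ n → Within m α β → Within n α β
Within-mono m≤n (ℓ , ℓ≤m , w) = ℓ , ℕ.≤-trans ℓ≤m m≤n , w

-- The search works on vectors because they have decidable equality, and in a small palette `Fin m`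
-- that is later mapped into `Fin k`.
record Move (a : Vec (Fin m) 7) : Set where
  constructor mk
  field
    vertex : Fin 7
    color  : Fin m
    effective : lookup a vertex ≢ color
  after : Vec (Fin m) 7
  after = a [ vertex ]≔ color
  field
    legal : Proper (lookup after)

open Move

data Path {m : ℕ} : ℕ → Vec (Fin m) 7 → Vec (Fin m) 7 → Set where
  done : ∀ {n a b} → a ≡ b → Path n a b
  move : ∀ {n a b} (μ : Move a) → Path n (after μ) b → Path (suc n) a b

-- An injective palette keeps each move effective and legal.
realise : {h : Fin m → Fin k} → Injective _≡_ _≡_ h → ∀ {a b} → Path n a b → (α β : Col k) →
  proj₁ α ≗ h ∘ lookup a → proj₁ β ≗ h ∘ lookup b → Within n α β
realise inj (done refl) α β α≗ β≗ = 0 , z≤n , here λ x → trans (α≗ x) (sym (β≗ x))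
realise {h = h} inj {a} (move (mk v c a≢c ok) path) α β α≗ β≗ =
  let ℓ , ℓ≤n , w = realise inj path γ β (λ _ → refl) β≗
  in suc ℓ , s≤s ℓ≤n , next {β = γ} (v , α≢γ , α≗γ) w
  where
  γ = coloring (Proper-∘ inj ok)
  α≢γ : proj₁ α v ≢ h (lookup (a [ v ]≔ c) v)
  α≢γ e = a≢c (trans (inj (trans (sym (α≗ v)) e)) (lookup∘update v a c))
  α≗γ : ∀ u → u ≢ v → proj₁ α u ≡ h (lookup (a [ v ]≔ c) u)
  α≗γ u u≢v = trans (α≗ u) (cong h (sym (lookup∘update′ u≢v a c)))

-- Greedy descent to stuck pairs

Stuck : (f g : Fin 7 → Fin k) → Set
Stuck f g = ∀ v → f v ≢ g v → ¬ Proper (recolor f v (g v))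

-- Induction on a bound `n` for the distance: each move to a final color lowers the distance by one,
-- and the surplus `s` is spent only at the stuck pair.
descend : (∀ (α β : Col k) → Stuck (proj₁ α) (proj₁ β) →
             Within (s + hamming (proj₁ α) (proj₁ β)) α β) →
  ∀ n (α β : Col k) → hamming (proj₁ α) (proj₁ β) ≤ n → Within (s + n) α β
descend {s = s} stuck n α@(f , _) β@(g , _) ≤n
  with any? (λ v → ¬? (f v ≟ g v) ×-dec proper? (recolor f v (g v)))
... | no ¬free =
  Within-mono (ℕ.+-monoʳ-≤ s ≤n) (stuck α β λ v f≢g ok → ¬free (v , f≢g , ok))
descend {s = s} stuck (suc n) α@(f , _) β@(g , _) ≤n | yes (v , f≢g , ok) =
  let ℓ , ℓ≤ , w = descend stuck n γ β (s≤s⁻¹ (subst (_≤ _) (hamming-recolor f g v f≢g) ≤n))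
  in suc ℓ , subst (suc ℓ ≤_) (sym (ℕ.+-suc s n)) (s≤s ℓ≤) ,
     next {β = γ} (v , (λ e → f≢g (trans e (recolor-here f v))) ,
                       λ u u≢v → sym (recolor-there f v u≢v)) w
  where γ = coloring ok
descend stuck zero α@(f , _) β@(g , _) ≤n | yes (v , f≢g , ok)
  with () ← subst (_≤ 0) (hamming-recolor f g v f≢g) ≤n

-- Decision procedures and path search

T-does : ∀ {P : Set} (P? : Dec P) → T (does P?) → P
T-does (true because [p]) _ = invert [p]

does-T : ∀ {P : Set} (P? : Dec P) → P → T (does P?)
does-T (true  because _)    _ = tt
does-T (false because [¬p]) p = invert [¬p] p

polychrome? : ((x , y , z) : Fin k × Fin k × Fin k) → Dec (¬ (x ≡ y × y ≡ z))
polychrome? (x , y , z) = ¬? ((x ≟ y) ×-dec (y ≟ z))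

-- proper? for the exhaustive checks: the truth value is a plain Boolean expression in the
-- seven colors, listed in the order of triangles.
vec-proper? : (a : Vec (Fin m) 7) → Dec (Proper (lookup a))
vec-proper? {m} a@(c₀ ∷ c₁ ∷ c₂ ∷ c₃ ∷ c₄ ∷ c₅ ∷ c₆ ∷ []) = map′ sound complete (T?
  -- The final `true` makes this expression definitionally equal to `all` over `triangles`, as
  -- `sound` and `complete` require.
  (poly c₀ c₁ c₃ ∧ poly c₁ c₂ c₄ ∧ poly c₂ c₃ c₅ ∧ poly c₃ c₄ c₆ ∧
   poly c₄ c₅ c₀ ∧ poly c₅ c₆ c₁ ∧ poly c₆ c₀ c₂ ∧
   poly c₀ c₂ c₃ ∧ poly c₁ c₃ c₄ ∧ poly c₂ c₄ c₅ ∧ poly c₃ c₅ c₆ ∧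
   poly c₄ c₆ c₀ ∧ poly c₅ c₀ c₁ ∧ poly c₆ c₁ c₂ ∧ true))
  where
  poly : Fin m → Fin m → Fin m → Bool
  poly x y z = not (does (x ≟ y) ∧ does (y ≟ z))

  colors : Triple → Fin m × Fin m × Fin m
  colors (x , y , z) = lookup a x , lookup a y , lookup a z

  sound : T (all (does ∘ polychrome? ∘ colors) triangles) → Proper (lookup a)
  sound = All.map (T-does (polychrome? _)) ∘ all⁺ _ triangles

  complete : Proper (lookup a) → T (all (does ∘ polychrome? ∘ colors) triangles)
  complete = all⁻ _ ∘ All.map (does-T (polychrome? _))

-- Matching on "because" in the following definitions leaves the proofs computed by the
-- deciders unevaluated.
move? : (a : Vec (Fin m) 7) → Fin 7 → Fin m → Maybe (Move a)
move? a v c with lookup a v ≟ c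
... | true  because _ = nothing
... | false because a≢c with vec-proper? (a [ v ]≔ c)
...   | false because _  = nothing
...   | true  because ok = just (mk v c (invert a≢c) (invert ok))

moves : (a : Vec (Fin m) 7) → List (Move a)
moves {m} a = mapMaybe (uncurry (move? a)) (cartesianProduct (allFin 7) (allFin m))

firstJust : ∀ {A B : Set} → (A → Maybe B) → List A → Maybe B
firstJust f []       = nothing
firstJust f (x ∷ xs) = f x <∣> firstJust f xs

-- s bounds the number of moves that do not give a vertex its final color.
via    : ∀ n (s : ℕ) (a b : Vec (Fin m) 7) → List (Move a) → Maybe (Path (suc n) a b)
search : ∀ n (s : ℕ) (a b : Vec (Fin m) 7) → Maybe (Path n a b)
detour : ∀ n (s : ℕ) (a b : Vec (Fin m) 7) → Maybe (Path (suc n) a b)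

via n s a b = firstJust (λ μ → Maybe.map (move μ) (search n s (after μ) b))

search n s a b with ≡-dec _≟_ a b
search n       s a b | true because a≡b = just (done (invert a≡b))
search zero    s a b | false because _  = nothing
search (suc n) s a b | false because _  =
  via n s a b (mapMaybe (λ v → move? a v (lookup b v)) (allFin 7)) <∣> detour n s a b

detour n zero    a b = nothing
detour n (suc s) a b = via n s a b (moves a)

distance : (a b : Vec (Fin m) 7) → ℕ
distance a b = hamming (lookup a) (lookup b)

-- Here `s` counts additional length, not detours. The first move is the only detour. At a vertex
-- without its final color it costs one extra move; at a vertex that has its final color it costs
-- two, since that color must be restored, and this needs `s` = 1.
escape : ∀ s (a b : Vec (Fin m) 7) → List (Move a) → Maybe (Path (suc (s + distance a b)) a b)
escape s a b μs with ≡-dec _≟_ a b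
-- Equal colorings are vacuously stuck, so this case does occur.
... | true  because a≡b = just (done (invert a≡b))
... | false because _   = via (s + distance a b) 0 a b μs

-- Enumeration of target colorings

choices : ∀ {A : Set} → Vec (List A) n → List (Vec A n)
choices []         = [] ∷ []
choices (xs ∷ xss) = cartesianProductWith _∷_ xs (choices xss)

∈-choices : ∀ {A : Set} (xss : Vec (List A) n) {a : Vec A n} →
  (∀ v → lookup a v ∈ lookup xss v) → a ∈ choices xss
∈-choices []         {[]}    _  = here refl
∈-choices (xs ∷ xss) {_ ∷ _} a∈ =
  ∈-cartesianProductWith⁺ _∷_ (a∈ zero) (∈-choices xss (a∈ ∘ suc))

module _ {P : Fin 7 → Fin m → Set} (P? : ∀ v c → Dec (P v c)) where

  options : Fin 7 → List (Fin m)
  options v = filter (P? v) (allFin m)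

  colorings : List (Vec (Fin m) 7)
  colorings = filter vec-proper? (choices (tabulate options))

  ∈-colorings : {a : Vec (Fin m) 7} → Proper (lookup a) → (∀ v → P v (lookup a v)) → a ∈ colorings
  ∈-colorings {a} ok Pa = ∈-filter⁺ vec-proper? (∈-choices (tabulate options) λ v →
    subst (lookup a v ∈_) (sym (lookup∘tabulate options v))
      (∈-filter⁺ (P? v) (∈-allFin _) (Pa v))) ok

-- Being stuck constrains each vertex and its target color separately, so the stuck targets are
-- found by filtering the colors of each vertex before the product is formed.
Blocked : Vec (Fin m) 7 → Fin 7 → Fin m → Set
Blocked p v c = lookup p v ≢ c → ¬ Proper (lookup (p [ v ]≔ c))

blocked? : (p : Vec (Fin m) 7) → ∀ v c → Dec (Blocked p v c)
blocked? p v c = ¬? (lookup p v ≟ c) →-dec ¬? (vec-proper? (p [ v ]≔ c))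

differs? : (p : Vec (Fin m) 7) → ∀ v c → Dec (lookup p v ≢ c)
differs? p v c = ¬? (lookup p v ≟ c)

-- Set partitions and the exhaustive checks

Pattern : ℕ → Set
Pattern n = ∃ λ m → Vec (Fin m) n

escapes : ℕ → Pattern 7 → Bool
escapes s (_ , p) = try-all (moves p)
  where
  try-all : List (Move p) → Bool
  try-all μs = all (λ b → is-just (escape s p b μs)) (colorings (blocked? p))

shifts : Pattern 7 → Bool
-- With `k` = 3, the test `3 ≤ᵇ m` guarantees that every color of a target lies in the palette of
-- `p`. The eight moves are seven final ones and one detour.
shifts (m , p) = (3 ≤ᵇ m) ∧ all (λ b → is-just (search 8 1 p b)) (colorings (differs? p))

-- Set partitions with numbered classes: the first vertex either opens a new class, which gets
-- number 0, or joins a class of the remaining vertices.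
partitions : ∀ n → List (Pattern n)
partitions zero    = (0 , []) ∷ []
partitions (suc n) = concatMap
  (λ (m , p) → (suc m , zero ∷ Vec.map suc p) ∷ List.map (λ c → m , c ∷ p) (allFin m))
  (partitions n)

-- Four colors suffice to resolve the stuck pairs, so a coloring with three classes is
-- given an unused fourth color.
spare : Pattern n → Pattern n
spare (m , p) = if m ≤ᵇ 3 then (suc m , Vec.map suc p) else (m , p)

few? : ∀ (x : Pattern n) → Dec (proj₁ x ≤ 3)
few? (m , _) = m ℕ.≤? 3

pattern-proper? : ∀ (x : Pattern 7) → Dec (Proper (lookup (proj₂ x)))
pattern-proper? (_ , p) = vec-proper? p

opaque
  partitions₇ : List (Pattern 7)
  partitions₇ = partitions 7

patterns₃ patterns₄ : List (Pattern 7)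
patterns₃ = filter pattern-proper? (filter few? partitions₇)
patterns₄ = filter pattern-proper? (List.map spare partitions₇)

opaque
  unfolding partitions₇

  escapes₄ : all (escapes 0) patterns₄ ≡ true
  escapes₄ = refl

  escapes₃ : all (escapes 1) patterns₃ ≡ true
  escapes₃ = refl

  shifts₃ : all shifts patterns₃ ≡ true
  shifts₃ = refl

-- Colorings as injectively colored partitions

record Factorisation (xs : List (Pattern n)) (f : Fin n → Fin k) : Set where
  field
    {classes} : ℕ
    vector    : Vec (Fin classes) n
    listed    : (classes , vector) ∈ xs
    palette   : Fin classes → Fin k
    injective : Injective _≡_ _≡_ palette
    factors   : f ≗ palette ∘ lookup vector

open Factorisation

∷-injective : {h : Fin m → Fin k} → Injective _≡_ _≡_ h → ∀ c → (∀ i → h i ≢ c) →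
  Injective _≡_ _≡_ (c F.∷ h)
∷-injective inj c fresh {zero}  {zero}  _ = refl
∷-injective inj c fresh {zero}  {suc j} e = ⊥-elim (fresh j (sym e))
∷-injective inj c fresh {suc i} {zero}  e = ⊥-elim (fresh i e)
∷-injective inj c fresh {suc i} {suc j} e = cong suc (inj e)

fresh-or-onto : (h : Fin m → Fin k) → (∃ λ c → ∀ i → h i ≢ c) ⊎ (∀ c → ∃ λ i → h i ≡ c)
fresh-or-onto h with any? (λ c → all? λ i → ¬? (h i ≟ c))
... | yes fresh = inj₁ fresh
... | no ¬fresh = inj₂ onto
  where
  onto : ∀ c → ∃ λ i → h i ≡ c
  onto c with any? (λ i → h i ≟ c)
  ... | yes hit = hit
  ... | no ¬hit = ⊥-elim (¬fresh (c , λ i e → ¬hit (i , e)))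

-- If every color were hit, choosing preimages would inject `Fin k` into `Fin m`.
fresh-color : {h : Fin m → Fin k} → m < k → ∃ λ c → ∀ i → h i ≢ c
fresh-color {h = h} m<k with fresh-or-onto h
... | inj₁ fresh = fresh
... | inj₂ onto  = ⊥-elim (ℕ.<⇒≱ m<k (injective⇒≤ section-injective))
  where
  section-injective : Injective _≡_ _≡_ (proj₁ ∘ onto)
  section-injective {c} {d} e =
    trans (sym (proj₂ (onto c))) (trans (cong h e) (proj₂ (onto d)))

-- A missed color would extend `h` to an injection of `Fin (suc m)` into `Fin k`.
injective⇒onto : {h : Fin m → Fin k} → Injective _≡_ _≡_ h → k ≤ m → ∀ c → ∃ λ i → h i ≡ c
injective⇒onto {h = h} inj k≤m with fresh-or-onto h
... | inj₂ onto = onto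
... | inj₁ (c , fresh) =
  ⊥-elim (ℕ.<⇒≱ (injective⇒≤ (∷-injective inj c fresh)) k≤m)

factorise : (f : Fin n → Fin k) → Factorisation (partitions n) f
factorise {zero} f = record
  { vector = [] ; listed = here refl ; palette = λ () ; injective = λ { {()} } ; factors = λ () }
factorise {suc n} {k} f = extend (factorise (f ∘ suc))
  where
  extend : Factorisation (partitions n) (f ∘ suc) → Factorisation (partitions (suc n)) f
  extend F with any? (λ c → palette F c ≟ f zero)
  ... | yes (c , hc≡f0) = record
    { vector = c ∷ vector F
    ; listed = ∈-concatMap⁺ _ (Any.map (λ { refl → there (∈-map⁺ _ (∈-allFin c)) }) (listed F))
    ; injective = injective F
    ; factors = λ { zero → sym hc≡f0 ; (suc v) → factors F v } }
  ... | no ¬hit = record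
    { vector = zero ∷ Vec.map suc (vector F)
    ; listed = ∈-concatMap⁺ _ (Any.map (λ { refl → here refl }) (listed F))
    ; palette = f zero F.∷ palette F
    ; injective = ∷-injective (injective F) (f zero) (λ i e → ¬hit (i , e))
    ; factors = λ { zero → refl
                  ; (suc v) → trans (factors F v)
                      (cong (f zero F.∷ palette F) (sym (lookup-map v suc (vector F)))) } }

relist : ∀ {xs ys} {f : Fin n → Fin k} (F : Factorisation xs f) →
  (classes F , vector F) ∈ ys → Factorisation ys f
relist F listed′ = record
  { listed = listed′ ; palette = palette F ; injective = injective F ; factors = factors F }

Factorisation-proper : ∀ {xs} {f : Fin 7 → Fin k} (F : Factorisation xs f) → Proper f →
  Proper (lookup (vector F))
Factorisation-proper F = Proper-∘⁻ (palette F) (lookup (vector F)) ∘ Proper-resp (factors F)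

restrict-proper : ∀ {xs} {f : Fin 7 → Fin k} → Proper f → Factorisation xs f →
  Factorisation (filter pattern-proper? xs) f
restrict-proper ok F = relist F (∈-filter⁺ pattern-proper? (listed F) (Factorisation-proper F ok))

add-spare : ∀ {xs} {f : Fin n → Fin k} → 4 ≤ k → Factorisation xs f →
  Factorisation (List.map spare xs) f
add-spare 4≤k F with classes F ≤ᵇ 3 in eq | ∈-map⁺ spare (listed F)
... | false | listed′ = relist F listed′
... | true  | listed′ = record
  { vector = Vec.map suc (vector F)
  ; listed = listed′
  ; palette = proj₁ new F.∷ palette F
  ; injective = ∷-injective (injective F) _ (proj₂ new)
  ; factors = λ v → trans (factors F v)
      (cong (proj₁ new F.∷ palette F) (sym (lookup-map v suc (vector F)))) }
  where
  new = fresh-color {h = palette F}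
    (ℕ.<-≤-trans (s≤s (ℕ.≤ᵇ⇒≤ (classes F) 3 (subst T (sym eq) tt))) 4≤k)

opaque
  unfolding partitions₇

  factorise₇ : (f : Fin 7 → Fin k) → Factorisation partitions₇ f
  factorise₇ = factorise

factorise₃ : (α : Col 3) → Factorisation patterns₃ (proj₁ α)
factorise₃ α = restrict-proper (proper α)
  (relist F (∈-filter⁺ few? (listed F) (injective⇒≤ (injective F))))
  where F = factorise₇ (proj₁ α)

factorise₄ : 4 ≤ k → (α : Col k) → Factorisation patterns₄ (proj₁ α)
factorise₄ 4≤k α = restrict-proper (proper α) (add-spare 4≤k (factorise₇ (proj₁ α)))

-- The upper bound

all-true : ∀ {A : Set} {p : A → Bool} {x xs} → all p xs ≡ true → x ∈ xs → T (p x)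
all-true {xs = xs} eq = All.lookup (all⁺ _ xs (subst T (sym eq) tt))

tabulated : (h : Fin m → Fin k) {f : Fin 7 → Fin k} (c : ∀ v → ∃ λ i → h i ≡ f v) →
  f ≗ h ∘ lookup (tabulate (proj₁ ∘ c))
tabulated h c v = trans (sym (proj₂ (c v))) (cong h (sym (lookup∘tabulate (proj₁ ∘ c) v)))

-- Both colorings are pulled back to the palette of the pattern of `α`. There `Stuck` becomes
-- `Blocked`, so the check applies, and the path found is mapped back.
stuck-walk : ∀ {xs} → all (escapes s) xs ≡ true → (α β : Col k) → Factorisation xs (proj₁ α) →
  Stuck (proj₁ α) (proj₁ β) → Within (suc s + hamming (proj₁ α) (proj₁ β)) α β
stuck-walk {s = s} checked α@(f , _) β@(g , _) F stuck =
  Within-mono (ℕ.+-monoʳ-≤ (suc s) distance≤hamming)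
    (realise (injective F) (to-witness-T (escape s p b (moves p)) found) α β (factors F) g≗)
  where
  p = vector F
  h = palette F

  -- Recoloring with a color that α does not use is always possible.
  used : ∀ v → ∃ λ i → h i ≡ g v
  used v with any? (λ w → f w ≟ g v)
  ... | yes (w , fw≡gv) = lookup p w , trans (sym (factors F w)) fw≡gv
  ... | no ¬used = ⊥-elim (stuck v (λ e → ¬used (v , e))
                     (recolor-unused f (proper α) v (g v) λ w e → ¬used (w , e)))

  b = tabulate (proj₁ ∘ used)

  g≗ : g ≗ h ∘ lookup b
  g≗ = tabulated h used

  distance≤hamming : distance p b ≤ hamming f g
  distance≤hamming = hamming-anti _ _ _ _ λ v e →
    injective F (trans (sym (factors F v)) (trans e (g≗ v)))

  blocked : ∀ v → Blocked p v (lookup b v)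
  blocked v p≢b ok = stuck v (λ e → p≢b (injective F (trans (sym (factors F v)) (trans e (g≗ v)))))
    (subst (Proper ∘ recolor f v) (sym (g≗ v))
      (Proper-resp (sym ∘ lookup-recolor h p (factors F) v (lookup b v))
        (Proper-∘ (injective F) ok)))

  found : T (is-just (escape s p b (moves p)))
  found = All.lookup (all⁺ _ _ (all-true checked (listed F)))
    (∈-colorings (blocked? p) (Proper-∘⁻ h (lookup b) (Proper-resp g≗ (proper β))) blocked)

-- The descent with two extra moves would give only 9 for a pair that differs on all seven vertices.
shift-walk : (α β : Col 3) → (∀ v → proj₁ α v ≢ proj₁ β v) → Within 8 α β
shift-walk α@(f , _) β@(g , _) f≢g =
  realise (injective F) (to-witness-T (search 8 1 p b) found) α β (factors F) g≗
  where
  F = factorise₃ α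
  p = vector F
  h = palette F

  checked : T (3 ≤ᵇ classes F) × T (all (λ b → is-just (search 8 1 p b)) (colorings (differs? p)))
  checked = Equivalence.to T-∧ (all-true shifts₃ (listed F))

  onto : ∀ v → ∃ λ i → h i ≡ g v
  onto v = injective⇒onto (injective F) (ℕ.≤ᵇ⇒≤ 3 (classes F) (proj₁ checked)) (g v)

  b = tabulate (proj₁ ∘ onto)

  g≗ : g ≗ h ∘ lookup b
  g≗ = tabulated h onto

  found : T (is-just (search 8 1 p b))
  found = All.lookup (all⁺ _ _ (proj₂ checked))
    (∈-colorings (differs? p) (Proper-∘⁻ h (lookup b) (Proper-resp g≗ (proper β)))
      λ v e → f≢g v (trans (factors F v) (trans (cong h e) (sym (g≗ v)))))

within-8 : 3 ≤ k → (α β : Col k) → Within 8 α β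
within-8 3≤k α β with ℕ.m≤n⇒m<n∨m≡n 3≤k
-- The bound 8 arises as 7 + 1 here and as 6 + 2 in the first case for three colors.
... | inj₁ 4≤k  = descend (λ α β → stuck-walk escapes₄ α β (factorise₄ 4≤k α))
                    7 α β (hamming≤n (proj₁ α) (proj₁ β))
... | inj₂ refl with hamming (proj₁ α) (proj₁ β) ℕ.≤? 6
...   | yes ≤6 = descend (λ α β → stuck-walk escapes₃ α β (factorise₃ α)) 6 α β ≤6
...   | no ≰6  = (shift-walk α β (n≤hamming⇒≢ (proj₁ α) (proj₁ β) (ℕ.≰⇒> ≰6)))

-- The lower bound

Direct : ℕ → (a b : Vec (Fin m) 7) → Set
Direct zero    a b = a ≡ b
Direct (suc n) a b = ∃ λ v → lookup a v ≢ lookup b v ×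
  Proper (lookup (a [ v ]≔ lookup b v)) × Direct n (a [ v ]≔ lookup b v) b

direct? : ∀ n (a b : Vec (Fin m) 7) → Dec (Direct n a b)
direct? zero    a b = ≡-dec _≟_ a b
direct? (suc n) a b = any? λ v →
  ¬? (lookup a v ≟ lookup b v) ×-dec vec-proper? (a [ v ]≔ lookup b v) ×-dec direct? n _ b

adjacent-recolor : (α γ : Col k) (adj : Adjacent α γ) →
  recolor (proj₁ α) (proj₁ adj) (proj₁ γ (proj₁ adj)) ≗ proj₁ γ
adjacent-recolor (f , _) (g , _) (v , _ , same) u with u ≟ v
... | yes refl = recolor-here f v
... | no u≢v   = trans (recolor-there f v u≢v) (same u u≢v)

-- A move brings the coloring closer to β only by giving a vertex its color in β.
move-hamming : (α γ β : Col k) (adj : Adjacent α γ) → let v = proj₁ adj in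
  (proj₁ γ v ≡ proj₁ β v × hamming (proj₁ α) (proj₁ β) ≤ suc (hamming (proj₁ γ) (proj₁ β)))
  ⊎ hamming (proj₁ α) (proj₁ β) ≤ hamming (proj₁ γ) (proj₁ β)
move-hamming α@(f , _) γ@(e , _) β@(g , _) adj@(v , f≢e , same) with e v ≟ g v
... | no e≢g  = inj₂ (hamming-anti f g e g λ u e≡g →
                  trans (same u λ { refl → e≢g e≡g }) e≡g)
... | yes e≡g = inj₁ (e≡g , (begin
  hamming f g                          ≡⟨ hamming-recolor f g v (f≢e ∘ λ f≡g → trans f≡g (sym e≡g)) ⟩
  suc (hamming (recolor f v (g v)) g)  ≤⟨ s≤s (hamming-anti _ g e g λ u → trans (recolored u)) ⟩
  suc (hamming e g)                    ∎))
  where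
  open ℕ.≤-Reasoning
  recolored : recolor f v (g v) ≗ e
  recolored = subst (λ c → recolor f v c ≗ e) e≡g (adjacent-recolor α γ adj)

hamming≤walk : {α β : Col k} → Walk α β ℓ → hamming (proj₁ α) (proj₁ β) ≤ ℓ
hamming≤walk {α = f , _} {g , _} (here f≗g) =
  ℕ.≤-trans (hamming-anti f g f f λ v _ → f≗g v) (ℕ.≤-reflexive (hamming-refl f))
  where
  hamming-refl : (f : Fin n → Fin k) → hamming f f ≡ 0
  hamming-refl {zero}  f = refl
  hamming-refl {suc n} f with f zero ≟ f zero
  ... | yes _ = hamming-refl (f ∘ suc)
  ... | no ¬r = ⊥-elim (¬r refl)
hamming≤walk {α = α} {β} (next {β = γ} adj w) with move-hamming α γ β adj
... | inj₁ (_ , closer) = ℕ.≤-trans closer (s≤s (hamming≤walk w))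
... | inj₂ farther      = ℕ.≤-trans farther (ℕ.m≤n⇒m≤1+n (hamming≤walk w))

lookup-injective : ∀ {A : Set} {a b : Vec A n} → lookup a ≗ lookup b → a ≡ b
lookup-injective {a = []}    {[]}    _ = refl
lookup-injective {a = _ ∷ _} {_ ∷ _} e = cong₂ _∷_ (e zero) (lookup-injective (e ∘ suc))

-- A walk no longer than the distance cannot afford a move that fails to lower it. So every move
-- sets a color of `β`, and the walk never leaves the palette `h`.
geodesic-direct : {h : Fin m → Fin k} → Injective _≡_ _≡_ h → ∀ {a b} {α β : Col k} →
  proj₁ α ≗ h ∘ lookup a → proj₁ β ≗ h ∘ lookup b →
  Walk α β ℓ → ℓ ≤ hamming (proj₁ α) (proj₁ β) → Direct ℓ a b
geodesic-direct inj α≗ β≗ (here α≗β) _ =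
  lookup-injective λ v → inj (trans (sym (α≗ v)) (trans (α≗β v) (β≗ v)))
geodesic-direct {h = h} inj {a} {b} {α} {β} α≗ β≗ (next {β = γ} adj@(v , α≢γ , _) w) ℓ<
  with move-hamming α γ β adj
... | inj₂ farther = ⊥-elim (ℕ.<⇒≱ ℓ< (ℕ.≤-trans farther (hamming≤walk w)))
... | inj₁ (γ≡β , closer) =
  v , (λ e → α≢γ (trans (α≗ v) (trans (cong h e) (sym γv≡)))) ,
  Proper-∘⁻ h (lookup (a [ v ]≔ lookup b v)) (Proper-resp γ≗ (proper γ)) ,
  geodesic-direct inj γ≗ β≗ w (s≤s⁻¹ (ℕ.≤-trans ℓ< closer))
  where
  γv≡ = trans γ≡β (β≗ v)
  γ≗ : proj₁ γ ≗ h ∘ lookup (a [ v ]≔ lookup b v)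
  γ≗ u = trans (sym (adjacent-recolor α γ adj u))
    (trans (cong (λ c → recolor (proj₁ α) v c u) γv≡) (lookup-recolor h a α≗ v (lookup b v) u))

-- Each has two classes of three cyclically consecutive vertices and a singleton. At the start only
-- `3F` can take its final color, and no continuation from there completes.
a₀ b₀ : Vec (Fin 3) 7
a₀ = 0F ∷ 0F ∷ 0F ∷ 1F ∷ 1F ∷ 1F ∷ 2F ∷ []
b₀ = 1F ∷ 1F ∷ 1F ∷ 2F ∷ 0F ∷ 0F ∷ 0F ∷ []

opaque
  ¬direct : ¬ Direct 7 a₀ b₀
  ¬direct = from-no (direct? 7 a₀ b₀)

  a₀-proper : Proper (lookup a₀)
  a₀-proper = from-yes (vec-proper? a₀)

  b₀-proper : Proper (lookup b₀)
  b₀-proper = from-yes (vec-proper? b₀)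

at-distance-8 : 3 ≤ k → Σ (Col k) λ α → Σ (Col k) λ β → ∀ ℓ → Walk α β ℓ → 8 ≤ ℓ
at-distance-8 {k} 3≤k = α , β , λ ℓ w → far (hamming≤walk w) w
  where
  h : Fin 3 → Fin k
  h i = inject≤ i 3≤k

  h-injective : Injective _≡_ _≡_ h
  h-injective = inject≤-injective 3≤k 3≤k _ _

  α β : Col k
  α = coloring (Proper-∘ h-injective a₀-proper)
  β = coloring (Proper-∘ h-injective b₀-proper)

  7≤hamming : 7 ≤ hamming (proj₁ α) (proj₁ β)
  -- The distance between `a₀` and `b₀` evaluates to 7.
  7≤hamming = hamming-anti (lookup a₀) (lookup b₀) _ _ λ _ → h-injective

  far : hamming (proj₁ α) (proj₁ β) ≤ ℓ → Walk α β ℓ → 8 ≤ ℓ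
  far ≤ℓ w with ℕ.m≤n⇒m<n∨m≡n (ℕ.≤-trans 7≤hamming ≤ℓ)
  ... | inj₁ 8≤ℓ  = 8≤ℓ
  ... | inj₂ refl = ⊥-elim (¬direct
                      (geodesic-direct h-injective (λ _ → refl) (λ _ → refl) w 7≤hamming))

theorem5 : (k : ℕ) → 3 ≤ k → Connected C7⟨3⟩ k × HasDiameter C7⟨3⟩ k 8
theorem5 k 3≤k =
  (λ α β → let ℓ , _ , w = within-8 3≤k α β in ℓ , w) , within-8 3≤k , at-distance-8 3≤k
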